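{- For each integer $r\ge 3$ let $f_{(R),r,1}(x)=1+x^2+x^{2^r}+x^{2^r+1}\in\mathbb{F}_2[x]$ (this is the reciprocal polynomial of $1+x+x^{2^r-1}+x^{2^r+1}$). Then for every $r\ge 3$ the polynomial $f_{(R),r,1}$ is robust and its order divides $4^r-1$; moreover $\displaystyle\lim_{r\to\infty}\gamma(f_{(R),r,1})=1$.
   Context: For a polynomial $f$ of degree $n$, its reciprocal polynomial is $f_{(R)}(x)=x^nf(1/x)$. For $f\in\mathbb{F}_2[x]$ with $f(0)=1$ and $\deg f\ge 1$, the order $\operatorname{ord}(f)$ is the least integer $D\ge 1$ such that $f(x)\mid 1+x^D$ in $\mathbb{F}_2[x]$. With $D=\operatorname{ord}(f)$, let $f^*(x)\in\mathbb{F}_2[x]$ be defined by $f(x)f^*(x)=1+x^D$. For $g\in\mathbb{F}_2[x]$, $\ell_1(g)$ is the number of monomials of $g$ (terms with coefficient $1$), and for $N\ge\deg g$, $\ell_{0,N}(g)$ is the number of exponents $k\in\{0,1,\dots,N\}$ for which the coefficient of $x^k$ in $g$ is $0$. Define $\gamma(f)=\ell_1(f^*)/D$. The polynomial $f$ is called robust if $\ell_1(f^*)>\ell_{0,D-1}(f^*)+1$, equivalently $\ell_1(f^*)>(D+1)/2$. -}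

module Defs where

open import Data.Integer.Base as ℤ using ()
open import Data.List.Base using (List; []; _∷_; _++_; length; filter; map; replicate; upTo)
open import Data.Nat.Base using (ℕ; zero; suc; _+_; _∸_; _^_; _≤_; _>_; >-nonZero)
open import Data.Parity.Base as ℙ using (Parity; 0ℙ; 1ℙ)
open import Data.Parity.Properties using (_≟_)
open import Data.Product.Base using (∃-syntax)
open import Data.Rational.Base as ℚ using (ℚ)
open import Relation.Binary.PropositionalEquality.Core using (_≡_)

-- The library's Parity, with its addition and multiplication, is the field 𝔽₂.
-- A polynomial over 𝔽₂ is the list of its coefficients, constant term first.
-- Trailing zeros are allowed, so equality of polynomials is _≈_, not _≡_.
Poly : Set
Poly = List Parity

coeff : Poly → ℕ → Parity
coeff []      _       = 0ℙ
coeff (a ∷ _) zero    = a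
coeff (_ ∷ p) (suc k) = coeff p k

infix 4 _≈_ _∣ₚ_

_≈_ : Poly → Poly → Set
p ≈ q = ∀ k → coeff p k ≡ coeff q k

infixl 6 _+ₚ_
infixl 7 _*ₚ_

_+ₚ_ : Poly → Poly → Poly
[]      +ₚ q       = q
(a ∷ p) +ₚ []      = a ∷ p
(a ∷ p) +ₚ (b ∷ q) = (a ℙ.+ b) ∷ (p +ₚ q)

-- (a + x p) q = a q + x (p q)
_*ₚ_ : Poly → Poly → Poly
[]      *ₚ q = []
(a ∷ p) *ₚ q = map (a ℙ.*_) q +ₚ (0ℙ ∷ (p *ₚ q))

1ₚ : Poly
1ₚ = 1ℙ ∷ []

X^_ : ℕ → Poly
X^ n = replicate n 0ℙ ++ 1ₚ

_∣ₚ_ : Poly → Poly → Set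
f ∣ₚ g = ∃[ q ] f *ₚ q ≈ g

ℓ₁ : Poly → ℕ
ℓ₁ g = length (filter (_≟ 1ℙ) g)

ℓ₀ : ℕ → Poly → ℕ
ℓ₀ N g = length (filter (λ k → coeff g k ≟ 0ℙ) (upTo (suc N)))

-- The degree of the zero polynomial is set to 0.  In a ∷ p, the tail p is
-- zero as a polynomial exactly when it has no coefficient 1.
deg : Poly → ℕ
deg []      = 0
deg (a ∷ p) with ℓ₁ p
... | zero  = 0
... | suc _ = suc (deg p)

-- xⁿ f(1/x) with n = deg f: the coefficient of xᵏ is that of xⁿ⁻ᵏ in f.
reciprocal : Poly → Poly
reciprocal f = map (λ k → coeff f (deg f ∸ k)) (upTo (suc (deg f)))

record IsOrder (f : Poly) (D : ℕ) : Set where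
  field
    positive : 1 ≤ D
    divides  : f ∣ₚ 1ₚ +ₚ X^ D
    least    : ∀ E → 1 ≤ E → f ∣ₚ 1ₚ +ₚ X^ E → D ≤ E

-- The order and the polynomial f* of f, together with the conditions on f
-- under which they are defined.  Both are determined by f (f* up to _≈_), but
-- computing the order takes a search, so they are carried as data.
record Order (f : Poly) : Set where
  field
    constant≡1 : coeff f 0 ≡ 1ℙ
    degree≥1   : 1 ≤ deg f
    ord        : ℕ
    isOrder    : IsOrder f ord
    star       : Poly
    star-eq    : f *ₚ star ≈ 1ₚ +ₚ X^ ord

  open IsOrder isOrder public

γ : {f : Poly} → Order f → ℚ
γ o = ((ℤ.+ ℓ₁ star) ℚ./ ord) {{>-nonZero positive}}
  where open Order o

Robust : {f : Poly} → Order f → Set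
Robust o = ℓ₁ star > ℓ₀ (ord ∸ 1) star + 1
  where open Order o

-- f_{r,1} and f_{(R),r,1}
f₁ : ℕ → Poly
f₁ r = 1ₚ +ₚ X^ 1 +ₚ X^ (2 ^ r ∸ 1) +ₚ X^ (2 ^ r + 1)

fR₁ : ℕ → Poly
fR₁ r = 1ₚ +ₚ X^ 2 +ₚ X^ (2 ^ r) +ₚ X^ (2 ^ r + 1)

{-# OPTIONS --safe #-}
module Submission where

open import Defs
open import Data.Nat.Base using (ℕ; _≤_; _∸_; _^_)
open import Data.Nat.Divisibility using (_∣_)
open import Data.Product.Base using (_×_; ∃-syntax)
open import Data.Rational.Base using (ℚ; 0ℚ; 1ℚ; _<_; _-_; ∣_∣)

import Algebra.Properties.CommutativeSemigroup as CommutativeSemigroupProperties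
open import Data.Empty using (⊥)
open import Data.Integer.Base as ℤ using ()
open import Data.Integer.Properties as ℤₚ using ()
open import Data.List.Base using ([]; _∷_; length; filter; map; applyUpTo)
open import Data.List.Properties using (map-upTo)
open import Data.Nat.Base as ℕ using (zero; suc; pred; z≤n; s≤s; _+_; _*_)
open import Data.Nat.Coprimality using (Coprime)
open import Data.Nat.DivMod using (_%_; _/_; m≡m%n+[m/n]*n; m%n<n; [m+kn]%n≡m%n; m<n⇒m%n≡m; +-distrib-/-∣ʳ; m*n/n≡m; m<n⇒m/n≡0; /-monoˡ-≤)
open import Data.Nat.Divisibility using (n∣m*n; ∣-reflexive)
open import Data.Nat.Properties as ℕₚ using (≤-refl; ≤-trans; <-cmp; +-suc; +-comm; +-assoc)
open import Data.Parity.Base as ℙ using (Parity; 0ℙ; 1ℙ) renaming (_+_ to infixl 6 _⊕_; _*_ to infixl 7 _⊗_)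
open import Data.Parity.Properties as ℙₚ using (_≟_; p+p≡0ℙ)
open import Data.Product.Base using (_,_; proj₁; proj₂)
open import Data.Rational.Base as ℚ using (mkℚ)
open import Data.Rational.Properties as ℚₚ using ()
open import Data.Rational.Unnormalised.Base as ℚᵘ using (mkℚᵘ; *≡*; *<*)
open import Data.Rational.Unnormalised.Properties as ℚᵘₚ using ()
open import Data.Sum.Base using (inj₁; inj₂)
open import Function.Base using (_∘_)
open import Relation.Binary.Definitions using (tri<; tri≈; tri>)
open import Relation.Binary.PropositionalEquality
import Relation.Binary.Reasoning.Setoid as ≈-Reasoning
open import Relation.Nullary using (yes; no; ¬_; contradiction)

open CommutativeSemigroupProperties ℙₚ.+-commutativeSemigroup using () renaming (interchange to ⊕-interchange)
open CommutativeSemigroupProperties ℕₚ.+-commutativeSemigroup using () renaming (interchange to +-interchange; x∙yz≈y∙xz to +-swap)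

-- Put q = 2^r.  Then f = 1 + x² + x^q + x^(q+1) = (1 + x)(1 + x + x^q), and the
-- order of f is M = q² - 1.  Write exponents as a + b q with a < q, and let
-- P a b be the binomial coefficient (a + b) C a modulo 2.  By Pascal's rule and
-- P a (q - 1) = [a = 0], the series G = Σ_{a,b<q} P a b x^(a+bq) satisfies
-- (1 + x + x^q) G = 1 + x^q + x^(q²).  Pascal's rule also gives the quotient by
-- 1 + x: for V = Σ_{a<q,b<q-1} (1 + P a (b+1)) x^(a+bq) we have
-- (1 + x) V = 1 + G, hence f V = x + x^(q²), and x⁻¹ V is (1 + x^M) / f.
-- V vanishes on its last row b = q - 1 and has coefficient 1 at the end of every
-- other row, so it has no period below M.  Its zeros among the first q² positions
-- are as many as the odd entries in a q × q square of Pascal's triangle, that is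
-- 3^r, because doubling q triples them.  So ℓ₁(f*) = 4^r - 3^r, and γ(f) → 1.

-- Power series over 𝔽₂

Series : Set
Series = ℕ → Parity

δ : ℕ → Series
δ n = coeff (X^ n)

infixl 6 _⊞_

_⊞_ : Series → Series → Series
(s ⊞ t) k = s k ⊕ t k

shift : ℕ → Series → Series
shift zero    s k       = s k
shift (suc n) s zero    = 0ℙ
shift (suc n) s (suc k) = shift n s k

infixl 7 _⋆_

-- Polynomials act on infinite series, so shifted series need no truncation and equality is
-- pointwise, unaffected by trailing zeros of lists.
_⋆_ : Poly → Series → Series
([]      ⋆ s) k       = 0ℙ
((a ∷ p) ⋆ s) zero    = a ⊗ s 0
((a ∷ p) ⋆ s) (suc k) = a ⊗ s (suc k) ⊕ (p ⋆ s) k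

coeff-+ : ∀ p q → coeff (p +ₚ q) ≗ coeff p ⊞ coeff q
coeff-+ []      q       k       = refl
coeff-+ (a ∷ p) []      k       = sym (ℙₚ.+-identityʳ _)
coeff-+ (a ∷ p) (b ∷ q) zero    = refl
coeff-+ (a ∷ p) (b ∷ q) (suc k) = coeff-+ p q k

coeff-map : ∀ a p k → coeff (map (a ⊗_) p) k ≡ a ⊗ coeff p k
coeff-map a []      k       = sym (ℙₚ.*-zeroʳ a)
coeff-map a (b ∷ p) zero    = refl
coeff-map a (b ∷ p) (suc k) = coeff-map a p k

coeff-* : ∀ p q → coeff (p *ₚ q) ≗ p ⋆ coeff q
coeff-* []      q k = refl
coeff-* (a ∷ p) q k with coeff-+ (map (a ⊗_) q) (0ℙ ∷ p *ₚ q) k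
coeff-* (a ∷ p) q zero    | e = trans e (trans (ℙₚ.+-identityʳ _) (coeff-map a q 0))
coeff-* (a ∷ p) q (suc k) | e = trans e (cong₂ _⊕_ (coeff-map a q (suc k)) (coeff-* p q k))

-- A coefficient of a product involves only earlier coefficients of the series. The bounded form is
-- what the induction in `⋆-cancel` can supply.
⋆-cong-≤ : ∀ p {s t} k → (∀ j → j ≤ k → s j ≡ t j) → (p ⋆ s) k ≡ (p ⋆ t) k
⋆-cong-≤ []      k       e = refl
⋆-cong-≤ (a ∷ p) zero    e = cong (a ⊗_) (e 0 z≤n)
⋆-cong-≤ (a ∷ p) (suc k) e = cong₂ _⊕_ (cong (a ⊗_) (e (suc k) ≤-refl))
  (⋆-cong-≤ p k (λ j j≤k → e j (ℕₚ.m≤n⇒m≤1+n j≤k)))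

⋆-cong : ∀ p {s t} → s ≗ t → p ⋆ s ≗ p ⋆ t
⋆-cong p e k = ⋆-cong-≤ p k (λ j _ → e j)

-- A polynomial with constant term 1 is a unit among power series: each coefficient of `s` is
-- recovered from the product and the earlier coefficients. This gives uniqueness of quotients
-- without any degree argument.
⋆-cancel : ∀ p {s t} → coeff p 0 ≡ 1ℙ → p ⋆ s ≗ p ⋆ t → s ≗ t
⋆-cancel (.1ℙ ∷ p) {s} {t} refl e k = below (suc k) k ≤-refl
  where
  -- The bound `n` turns strong induction on `k` into structural recursion.
  below : ∀ n k → k ℕ.< n → s k ≡ t k
  below (suc n) zero    _         = e 0
  below (suc n) (suc k) (s≤s k<n) = ℙₚ.+-cancelʳ-≡ ((p ⋆ s) k) (s (suc k)) (t (suc k))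
    (trans (e (suc k)) (cong (t (suc k) ⊕_)
      (sym (⋆-cong-≤ p k (λ j j≤k → below n j (ℕₚ.≤-<-trans j≤k k<n))))))

⋆-distribʳ : ∀ p q s → (p +ₚ q) ⋆ s ≗ p ⋆ s ⊞ q ⋆ s
⋆-distribʳ []      q       s k       = refl
⋆-distribʳ (a ∷ p) []      s k       = sym (ℙₚ.+-identityʳ _)
⋆-distribʳ (a ∷ p) (b ∷ q) s zero    = ℙₚ.*-distribʳ-+ (s 0) a b
⋆-distribʳ (a ∷ p) (b ∷ q) s (suc k) = trans
  (cong₂ _⊕_ (ℙₚ.*-distribʳ-+ (s (suc k)) a b) (⋆-distribʳ p q s k))
  (⊕-interchange (a ⊗ s (suc k)) (b ⊗ s (suc k)) _ _)

⋆-distribˡ : ∀ p s t → p ⋆ (s ⊞ t) ≗ p ⋆ s ⊞ p ⋆ t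
⋆-distribˡ []      s t k       = refl
⋆-distribˡ (a ∷ p) s t zero    = ℙₚ.*-distribˡ-+ a (s 0) (t 0)
⋆-distribˡ (a ∷ p) s t (suc k) = trans
  (cong₂ _⊕_ (ℙₚ.*-distribˡ-+ a (s (suc k)) (t (suc k))) (⋆-distribˡ p s t k))
  (⊕-interchange (a ⊗ s (suc k)) (a ⊗ t (suc k)) _ _)

shift-cong : ∀ n {s t} → s ≗ t → shift n s ≗ shift n t
shift-cong zero    e k       = e k
shift-cong (suc n) e zero    = refl
shift-cong (suc n) e (suc k) = shift-cong n e k

shift-⊞ : ∀ n s t → shift n (s ⊞ t) ≗ shift n s ⊞ shift n t
shift-⊞ zero    s t k       = refl
shift-⊞ (suc n) s t zero    = refl
shift-⊞ (suc n) s t (suc k) = shift-⊞ n s t k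

shift-+ : ∀ n s k → shift n s (n + k) ≡ s k
shift-+ zero    s k = refl
shift-+ (suc n) s k = shift-+ n s k

shift-< : ∀ {n k} s → k ℕ.< n → shift n s k ≡ 0ℙ
shift-< {suc n} {zero}  s _         = refl
shift-< {suc n} {suc k} s (s≤s k<n) = shift-< s k<n

shift-shift : ∀ m n s → shift m (shift n s) ≗ shift (m + n) s
shift-shift zero    n s k       = refl
shift-shift (suc m) n s zero    = refl
shift-shift (suc m) n s (suc k) = shift-shift m n s k

shift-δ : ∀ m n → shift m (δ n) ≗ δ (m + n)
shift-δ zero    n k       = refl
shift-δ (suc m) n zero    = refl
shift-δ (suc m) n (suc k) = shift-δ m n k

⋆-shift-1 : ∀ p s → p ⋆ shift 1 s ≗ shift 1 (p ⋆ s)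
⋆-shift-1 []      s zero          = refl
⋆-shift-1 []      s (suc k)       = refl
⋆-shift-1 (a ∷ p) s zero          = ℙₚ.*-zeroʳ a
⋆-shift-1 (a ∷ p) s (suc zero)    = trans (cong (a ⊗ s 0 ⊕_) (⋆-shift-1 p s 0)) (ℙₚ.+-identityʳ _)
⋆-shift-1 (a ∷ p) s (suc (suc k)) = cong (a ⊗ s (suc k) ⊕_) (⋆-shift-1 p s (suc k))

⋆-shift : ∀ n p s → p ⋆ shift n s ≗ shift n (p ⋆ s)
⋆-shift zero    p s k = refl
⋆-shift (suc n) p s k = begin
  (p ⋆ shift (suc n) s) k       ≡⟨ ⋆-cong p (λ j → shift-shift 1 n s j) k ⟨
  (p ⋆ shift 1 (shift n s)) k   ≡⟨ ⋆-shift-1 p (shift n s) k ⟩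
  shift 1 (p ⋆ shift n s) k     ≡⟨ shift-cong 1 (⋆-shift n p s) k ⟩
  shift 1 (shift n (p ⋆ s)) k   ≡⟨ shift-shift 1 n (p ⋆ s) k ⟩
  shift (suc n) (p ⋆ s) k       ∎
  where open ≡-Reasoning

X^-⋆ : ∀ n s → X^ n ⋆ s ≗ shift n s
X^-⋆ zero    s zero    = refl
X^-⋆ zero    s (suc k) = ℙₚ.+-identityʳ _
X^-⋆ (suc n) s zero    = refl
X^-⋆ (suc n) s (suc k) = X^-⋆ n s k

shift-δ-zero : ∀ n → shift n (δ 0) ≗ δ n
shift-δ-zero n k = trans (shift-δ n 0 k) (cong (λ m → δ m k) (ℕₚ.+-identityʳ n))

-- The right-hand side is (1 + x^D)(1 + x^E), symmetric in D and E. Two quotients by the same `p`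
-- can therefore be compared by cross-multiplication.
⋆-X^+1 : ∀ p s D E → p ⋆ s ≗ δ 0 ⊞ δ E →
  p ⋆ (s ⊞ shift D s) ≗ (δ 0 ⊞ δ E) ⊞ (δ D ⊞ δ (D + E))
⋆-X^+1 p s D E e k = trans (⋆-distribˡ p s (shift D s) k) (cong₂ _⊕_ (e k) (begin
  (p ⋆ shift D s) k                   ≡⟨ ⋆-shift D p s k ⟩
  shift D (p ⋆ s) k                   ≡⟨ shift-cong D e k ⟩
  shift D (δ 0 ⊞ δ E) k               ≡⟨ shift-⊞ D (δ 0) (δ E) k ⟩
  shift D (δ 0) k ⊕ shift D (δ E) k   ≡⟨ cong₂ _⊕_ (shift-δ-zero D k) (shift-δ D E k) ⟩
  δ D k ⊕ δ (D + E) k                 ∎))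
  where open ≡-Reasoning

δ-≢ : ∀ {m k} → m ≢ k → δ m k ≡ 0ℙ
δ-≢ {zero}  {zero}  m≢k = contradiction refl m≢k
δ-≢ {zero}  {suc k} m≢k = refl
δ-≢ {suc m} {zero}  m≢k = refl
δ-≢ {suc m} {suc k} m≢k = δ-≢ (m≢k ∘ cong suc)

δ-refl : ∀ m → δ m m ≡ 1ℙ
δ-refl zero    = refl
δ-refl (suc m) = δ-refl m

coeff-≥length : ∀ p {k} → length p ≤ k → coeff p k ≡ 0ℙ
coeff-≥length []      _         = refl
coeff-≥length (a ∷ p) (s≤s l≤k) = coeff-≥length p l≤k

coeff-applyUpTo : ∀ (s : Series) {n k} → k ℕ.< n → coeff (applyUpTo s n) k ≡ s k
coeff-applyUpTo s {suc n} {zero}  _         = refl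
coeff-applyUpTo s {suc n} {suc k} (s≤s k<n) = coeff-applyUpTo (s ∘ suc) k<n

coeff-applyUpTo-≥ : ∀ (s : Series) {n k} → n ≤ k → coeff (applyUpTo s n) k ≡ 0ℙ
coeff-applyUpTo-≥ s {zero}  _         = refl
coeff-applyUpTo-≥ s {suc n} (s≤s n≤k) = coeff-applyUpTo-≥ (s ∘ suc) n≤k

-- Pascal's triangle modulo 2

-- The parity of the binomial coefficient (a + b) C a.
pascal : ℕ → ℕ → Parity
pascal zero    b       = 1ℙ
pascal (suc a) zero    = 1ℙ
pascal (suc a) (suc b) = pascal a (suc b) ⊕ pascal (suc a) b

pascal-zeroʳ : ∀ a → pascal a 0 ≡ 1ℙ
pascal-zeroʳ zero    = refl
pascal-zeroʳ (suc a) = refl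

pascal-comm : ∀ a b → pascal a b ≡ pascal b a
pascal-comm zero    b       = sym (pascal-zeroʳ b)
pascal-comm (suc a) zero    = refl
pascal-comm (suc a) (suc b) = trans
  (cong₂ _⊕_ (pascal-comm a (suc b)) (pascal-comm (suc a) b))
  (ℙₚ.+-comm (pascal (suc b) a) (pascal b (suc a)))

double : ℕ → ℕ
double zero    = zero
double (suc n) = suc (suc (double n))

double≡2* : ∀ n → double n ≡ 2 * n
double≡2* zero    = refl
double≡2* (suc n) = cong suc (trans (cong suc (double≡2* n)) (sym (+-suc n (n + 0))))

pascal-odd-odd   : ∀ a b → pascal (suc (double a)) (suc (double b)) ≡ 0ℙ
pascal-even-even : ∀ a b → pascal (double a) (double b) ≡ pascal a b
pascal-odd-even  : ∀ a b → pascal (suc (double a)) (double b) ≡ pascal a b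
pascal-even-odd  : ∀ a b → pascal (double a) (suc (double b)) ≡ pascal a b

pascal-odd-odd a b = trans (cong₂ _⊕_ (pascal-even-odd a b) (pascal-odd-even a b)) (p+p≡0ℙ (pascal a b))
pascal-even-even zero    b       = refl
pascal-even-even (suc a) zero    = refl
pascal-even-even (suc a) (suc b) = cong₂ _⊕_ (pascal-odd-even a (suc b)) (pascal-even-odd (suc a) b)
pascal-odd-even a zero    = sym (pascal-zeroʳ a)
pascal-odd-even a (suc b) = trans
  (cong₂ _⊕_ (pascal-even-even a (suc b)) (pascal-odd-odd a b)) (ℙₚ.+-identityʳ _)
pascal-even-odd zero    b = refl
pascal-even-odd (suc a) b = cong₂ _⊕_ (pascal-odd-odd a b) (pascal-even-even (suc a) b)

-- This is 2^r - 1, built digit by digit so that its lowest binary digit 1 is visible to the parity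
-- lemmas.
mersenne : ℕ → ℕ
mersenne zero    = 0
mersenne (suc r) = suc (double (mersenne r))

2^r≡1+mersenne : ∀ r → 2 ^ r ≡ suc (mersenne r)
2^r≡1+mersenne zero    = refl
2^r≡1+mersenne (suc r) = trans (cong (2 *_) (2^r≡1+mersenne r)) (sym (double≡2* (suc (mersenne r))))

data Parted : ℕ → Set where
  even : ∀ a → Parted (double a)
  odd  : ∀ a → Parted (suc (double a))

parted : ∀ n → Parted n
parted zero = even zero
parted (suc n) with parted n
... | even a = odd a
... | odd a  = even (suc a)

double-cancel-≤ : ∀ a b → double a ≤ suc (double b) → a ≤ b
double-cancel-≤ zero    b       _               = z≤n
double-cancel-≤ (suc a) (suc b) (s≤s (s≤s a≤b)) = s≤s (double-cancel-≤ a b a≤b)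
double-cancel-≤ (suc a) zero    (s≤s ())

-- All r binary digits of 2^r - 1 are 1, so adding a nonzero number of at most r digits causes a
-- carry. An odd `a` carries at once; for an even one the last digit is dropped.
pascal-mersenne : ∀ r {a} → 1 ≤ a → a ≤ mersenne r → pascal a (mersenne r) ≡ 0ℙ
pascal-mersenne zero    (s≤s _) ()
pascal-mersenne (suc r) {a} 1≤a a≤m with parted a
... | odd b        = pascal-odd-odd b (mersenne r)
... | even (suc b) = trans (pascal-even-odd (suc b) (mersenne r))
  (pascal-mersenne r (s≤s z≤n) (double-cancel-≤ (suc b) (mersenne r) a≤m))

-- Counting

∑ : (ℕ → ℕ) → ℕ → ℕ
∑ φ zero    = 0
∑ φ (suc n) = φ 0 + ∑ (φ ∘ suc) n

∑-cong : ∀ {φ ψ} n → (∀ {k} → k ℕ.< n → φ k ≡ ψ k) → ∑ φ n ≡ ∑ ψ n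
∑-cong zero    e = refl
∑-cong (suc n) e = cong₂ _+_ (e (s≤s z≤n)) (∑-cong n (λ k<n → e (s≤s k<n)))

∑-zero : ∀ {φ} n → (∀ k → φ k ≡ 0) → ∑ φ n ≡ 0
∑-zero zero    e = refl
∑-zero (suc n) e = cong₂ _+_ (e 0) (∑-zero n (e ∘ suc))

∑-+ : ∀ φ ψ n → ∑ (λ k → φ k + ψ k) n ≡ ∑ φ n + ∑ ψ n
∑-+ φ ψ zero    = refl
∑-+ φ ψ (suc n) = trans (cong (φ 0 + ψ 0 +_) (∑-+ (φ ∘ suc) (ψ ∘ suc) n))
  (+-interchange (φ 0) (ψ 0) (∑ (φ ∘ suc) n) (∑ (ψ ∘ suc) n))

∑-split : ∀ φ m k → ∑ φ (m + k) ≡ ∑ φ m + ∑ (λ j → φ (m + j)) k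
∑-split φ zero    k = refl
∑-split φ (suc m) k = trans (cong (φ 0 +_) (∑-split (φ ∘ suc) m k)) (sym (+-assoc (φ 0) _ _))

∑-last : ∀ φ n → ∑ φ (suc n) ≡ φ n + ∑ φ n
∑-last φ zero    = refl
∑-last φ (suc n) = trans (cong (φ 0 +_) (∑-last (φ ∘ suc) n)) (+-swap (φ 0) (φ (suc n)) _)

∑-double : ∀ φ n → ∑ φ (double n) ≡ ∑ (λ k → φ (double k) + φ (suc (double k))) n
∑-double φ zero    = refl
∑-double φ (suc n) = trans (cong (λ x → φ 0 + (φ 1 + x)) (∑-double (φ ∘ suc ∘ suc) n))
  (sym (+-assoc (φ 0) (φ 1) _))

∑-byRows : ∀ φ b q → ∑ φ (b * q) ≡ ∑ (λ j → ∑ (λ a → φ (a + j * q)) q) b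
∑-byRows φ zero    q = refl
∑-byRows φ (suc b) q = trans (∑-split φ q (b * q)) (cong₂ _+_
  (∑-cong q (λ {k} _ → cong φ (sym (ℕₚ.+-identityʳ k))))
  (trans (∑-byRows (λ j → φ (q + j)) b q)
    (∑-cong b (λ {j} _ → ∑-cong q (λ {a} _ → cong φ (+-swap q a (j * q)))))))

bit : Parity → ℕ
bit 0ℙ = 0
bit 1ℙ = 1

ones zeros : Series → ℕ → ℕ
ones  s = ∑ (λ k → bit (s k))
zeros s = ∑ (λ k → bit (1ℙ ⊕ s k))

ones+zeros : ∀ s n → ones s n + zeros s n ≡ n
ones+zeros s n = trans (sym (∑-+ (λ k → bit (s k)) (λ k → bit (1ℙ ⊕ s k)) n)) (total s n)
  where
  total : ∀ (s : Series) n → ∑ (λ k → bit (s k) + bit (1ℙ ⊕ s k)) n ≡ n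
  total s zero = refl
  total s (suc n) with s 0
  ... | 0ℙ = cong suc (total (s ∘ suc) n)
  ... | 1ℙ = cong suc (total (s ∘ suc) n)

ℓ₁≡ones : ∀ p {n} → length p ≤ n → ℓ₁ p ≡ ones (coeff p) n
ℓ₁≡ones []       {n} _         = sym (∑-zero n (λ _ → refl))
ℓ₁≡ones (0ℙ ∷ p) (s≤s l≤n) = ℓ₁≡ones p l≤n
ℓ₁≡ones (1ℙ ∷ p) (s≤s l≤n) = cong suc (ℓ₁≡ones p l≤n)

ℓ₀≡zeros : ∀ N p → ℓ₀ N p ≡ zeros (coeff p) (suc N)
ℓ₀≡zeros N p = go (λ k → k) (suc N)
  where
  go : ∀ (φ : ℕ → ℕ) n →
    length (filter (λ k → coeff p k ≟ 0ℙ) (applyUpTo φ n)) ≡ zeros (coeff p ∘ φ) n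
  go φ zero = refl
  go φ (suc n) with coeff p (φ 0)
  ... | 0ℙ = cong suc (go (φ ∘ suc) n)
  ... | 1ℙ = go (φ ∘ suc) n

columnSum : ℕ → ℕ → ℕ
columnSum q b = ∑ (λ a → bit (pascal a b)) q

squareSum : ℕ → ℕ
squareSum q = ∑ (columnSum q) q

columnSum-even : ∀ q b → columnSum (double q) (double b) ≡ columnSum q b + columnSum q b
columnSum-even q b = trans (∑-double (λ a → bit (pascal a (double b))) q) (trans
  (∑-cong q (λ {a} _ → cong₂ (λ x y → bit x + bit y) (pascal-even-even a b) (pascal-odd-even a b)))
  (∑-+ (λ a → bit (pascal a b)) (λ a → bit (pascal a b)) q))

columnSum-odd : ∀ q b → columnSum (double q) (suc (double b)) ≡ columnSum q b
columnSum-odd q b = trans (∑-double (λ a → bit (pascal a (suc (double b)))) q)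
  (∑-cong q (λ {a} _ → trans
    (cong₂ (λ x y → bit x + bit y) (pascal-even-odd a b) (pascal-odd-odd a b)) (ℕₚ.+-identityʳ _)))

-- Of the four parity classes of (a, b), the odd-odd one contributes nothing and each of the other
-- three is a copy of the smaller square.
squareSum-double : ∀ q → squareSum (double q) ≡ 3 * squareSum q
squareSum-double q = begin
  ∑ (columnSum (double q)) (double q)
    ≡⟨ ∑-double (columnSum (double q)) q ⟩
  ∑ (λ b → columnSum (double q) (double b) + columnSum (double q) (suc (double b))) q
    ≡⟨ ∑-cong q (λ {b} _ → cong₂ _+_ (columnSum-even q b) (columnSum-odd q b)) ⟩
  ∑ (λ b → c b + c b + c b) q
    ≡⟨ ∑-+ (λ b → c b + c b) c q ⟩
  ∑ (λ b → c b + c b) q + s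
    ≡⟨ cong (_+ s) (∑-+ c c q) ⟩
  s + s + s
    ≡⟨ +-comm (s + s) s ⟩
  s + (s + s)
    ≡⟨ cong (λ x → s + (s + x)) (ℕₚ.+-identityʳ s) ⟨
  3 * s ∎
  where
  open ≡-Reasoning
  c = columnSum q
  s = squareSum q

squareSum-2^ : ∀ r → squareSum (2 ^ r) ≡ 3 ^ r
squareSum-2^ zero    = refl
squareSum-2^ (suc r) = begin
  squareSum (2 * 2 ^ r)      ≡⟨ cong squareSum (double≡2* (2 ^ r)) ⟨
  squareSum (double (2 ^ r)) ≡⟨ squareSum-double (2 ^ r) ⟩
  3 * squareSum (2 ^ r)      ≡⟨ cong (3 *_) (squareSum-2^ r) ⟩
  3 * 3 ^ r                  ∎
  where open ≡-Reasoning

-- Degrees and reciprocals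

ℓ₁-pos : ∀ p {k} → coeff p k ≡ 1ℙ → ℓ₁ p ≢ 0
ℓ₁-pos (1ℙ ∷ p) {k}     _ ()
ℓ₁-pos (0ℙ ∷ p) {suc k} e = ℓ₁-pos p e

ℓ₁-zero : ∀ p → (∀ k → coeff p k ≡ 0ℙ) → ℓ₁ p ≡ 0
ℓ₁-zero p e = trans (ℓ₁≡ones p ≤-refl) (∑-zero (length p) (λ k → cong bit (e k)))

deg-unique : ∀ p n → coeff p n ≡ 1ℙ → (∀ {k} → n ℕ.< k → coeff p k ≡ 0ℙ) → deg p ≡ n
deg-unique (a ∷ p) zero _ high with ℓ₁ p | ℓ₁-zero p (λ k → high {suc k} (s≤s z≤n))
... | zero | _ = refl
deg-unique (a ∷ p) (suc n) top high with ℓ₁ p | ℓ₁-pos p top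
... | zero  | pos = contradiction refl pos
... | suc _ | _   = cong suc (deg-unique p n top (λ n<k → high (s≤s n<k)))

coeff-reciprocal : ∀ p {k} → k ≤ deg p → coeff (reciprocal p) k ≡ coeff p (deg p ∸ k)
coeff-reciprocal p {k} k≤d = trans (cong (λ l → coeff l k) (map-upTo (λ k → coeff p (deg p ∸ k)) (suc (deg p))))
  (coeff-applyUpTo (λ k → coeff p (deg p ∸ k)) (s≤s k≤d))

coeff-reciprocal-> : ∀ p {k} → deg p ℕ.< k → coeff (reciprocal p) k ≡ 0ℙ
coeff-reciprocal-> p {k} d<k = trans (cong (λ l → coeff l k) (map-upTo (λ k → coeff p (deg p ∸ k)) (suc (deg p))))
  (coeff-applyUpTo-≥ (λ k → coeff p (deg p ∸ k)) d<k)

-- Truncated subtraction from `c` is an involution only on 0, ..., c, which is why both exponents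
-- are bounded.
δ-reflect : ∀ {m k c} → m ≤ c → k ≤ c → δ m (c ∸ k) ≡ δ (c ∸ m) k
δ-reflect {m} {k} {c} m≤c k≤c with m ℕₚ.≟ c ∸ k
... | yes refl = trans (δ-refl (c ∸ k))
  (sym (trans (cong (λ j → δ j k) (ℕₚ.m∸[m∸n]≡n k≤c)) (δ-refl k)))
... | no m≢ = trans (δ-≢ m≢) (sym (δ-≢ (λ e → m≢ (trans (sym (ℕₚ.m∸[m∸n]≡n m≤c)) (cong (c ∸_) {c ∸ m} {k} e)))))

fourTerms : ℕ → ℕ → ℕ → Poly
fourTerms a b c = 1ₚ +ₚ X^ a +ₚ X^ b +ₚ X^ c

coeff-fourTerms : ∀ a b c → coeff (fourTerms a b c) ≗ δ 0 ⊞ δ a ⊞ δ b ⊞ δ c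
coeff-fourTerms a b c k = trans (coeff-+ (1ₚ +ₚ X^ a +ₚ X^ b) (X^ c) k) (cong (_⊕ δ c k)
  (trans (coeff-+ (1ₚ +ₚ X^ a) (X^ b) k) (cong (_⊕ δ b k) (coeff-+ 1ₚ (X^ a) k))))

coeff-fourTerms-> : ∀ {a b c k} → a ≤ c → b ≤ c → c ℕ.< k → coeff (fourTerms a b c) k ≡ 0ℙ
coeff-fourTerms-> {a} {b} {c} {k} a≤c b≤c c<k = trans (coeff-fourTerms a b c k)
  (cong₂ _⊕_ (cong₂ _⊕_ (cong₂ _⊕_ (off z≤n) (off a≤c)) (off b≤c)) (off ≤-refl))
  where
  off : ∀ {m} → m ≤ c → δ m k ≡ 0ℙ
  off m≤c = δ-≢ (ℕₚ.<⇒≢ (ℕₚ.≤-<-trans m≤c c<k))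

deg-fourTerms : ∀ {a b c} → a ℕ.< c → b ℕ.< c → deg (fourTerms a b c) ≡ c
deg-fourTerms {a} {b} {c} a<c b<c = deg-unique (fourTerms a b c) c
  (trans (coeff-fourTerms a b c c) (cong₂ _⊕_
    (cong₂ _⊕_ (cong₂ _⊕_ (off (ℕₚ.≤-<-trans z≤n a<c)) (off a<c)) (off b<c)) (δ-refl c)))
  (coeff-fourTerms-> (ℕₚ.<⇒≤ a<c) (ℕₚ.<⇒≤ b<c))
  where
  off : ∀ {m} → m ℕ.< c → δ m c ≡ 0ℙ
  off m<c = δ-≢ (ℕₚ.<⇒≢ m<c)

reciprocal-fourTerms : ∀ {a b c} → a ℕ.< c → b ℕ.< c → 1 ≤ a → 1 ≤ b →
  fourTerms (c ∸ b) (c ∸ a) c ≈ reciprocal (fourTerms a b c)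
reciprocal-fourTerms {a} {b} {c} a<c b<c 1≤a 1≤b k with ℕₚ.<-≤-connex c k
-- Above the degree the reflection c ∸ k is stuck at 0, so this range is settled by both sides
-- vanishing.
... | inj₁ c<k = trans (coeff-fourTerms-> (ℕₚ.m∸n≤m c b) (ℕₚ.m∸n≤m c a) c<k)
  (sym (coeff-reciprocal-> p (subst (ℕ._< k) (sym (deg-fourTerms a<c b<c)) c<k)))
  where p = fourTerms a b c
... | inj₂ k≤c = begin
  coeff (fourTerms (c ∸ b) (c ∸ a) c) k
    ≡⟨ coeff-fourTerms (c ∸ b) (c ∸ a) c k ⟩
  δ 0 k ⊕ δ (c ∸ b) k ⊕ δ (c ∸ a) k ⊕ δ c k
    ≡⟨ reverse (δ 0 k) (δ (c ∸ b) k) (δ (c ∸ a) k) (δ c k) ⟩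
  δ c k ⊕ δ (c ∸ a) k ⊕ δ (c ∸ b) k ⊕ δ 0 k
    ≡⟨ cong (λ m → δ c k ⊕ δ (c ∸ a) k ⊕ δ (c ∸ b) k ⊕ δ m k) (ℕₚ.n∸n≡0 c) ⟨
  δ c k ⊕ δ (c ∸ a) k ⊕ δ (c ∸ b) k ⊕ δ (c ∸ c) k
    ≡⟨ cong₂ _⊕_ (cong₂ _⊕_ (cong₂ _⊕_ (δ-reflect z≤n k≤c) (δ-reflect (ℕₚ.<⇒≤ a<c) k≤c))
         (δ-reflect (ℕₚ.<⇒≤ b<c) k≤c)) (δ-reflect ≤-refl k≤c) ⟨
  δ 0 (c ∸ k) ⊕ δ a (c ∸ k) ⊕ δ b (c ∸ k) ⊕ δ c (c ∸ k)
    ≡⟨ coeff-fourTerms a b c (c ∸ k) ⟨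
  coeff p (c ∸ k)
    ≡⟨ cong (λ d → coeff p (d ∸ k)) (deg-fourTerms a<c b<c) ⟨
  coeff p (deg p ∸ k)
    ≡⟨ coeff-reciprocal p (subst (k ≤_) (sym (deg-fourTerms a<c b<c)) k≤c) ⟨
  coeff (reciprocal p) k ∎
  where
  open ≡-Reasoning
  p = fourTerms a b c
  reverse : ∀ w x y z → w ⊕ x ⊕ y ⊕ z ≡ z ⊕ y ⊕ x ⊕ w
  reverse w x y z = trans (ℙₚ.+-comm (w ⊕ x ⊕ y) z) (trans (cong (z ⊕_)
    (trans (ℙₚ.+-comm (w ⊕ x) y) (cong (y ⊕_) (ℙₚ.+-comm w x))))
    (trans (sym (ℙₚ.+-assoc z y (x ⊕ w))) (sym (ℙₚ.+-assoc (z ⊕ y) x w))))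

-- Series read row by row from a table

cut : ℕ → Series
cut zero    b       = 0ℙ
cut (suc n) zero    = 1ℙ
cut (suc n) (suc b) = cut n b

cut-< : ∀ {n b} → b ℕ.< n → cut n b ≡ 1ℙ
cut-< {suc n} {zero}  _         = refl
cut-< {suc n} {suc b} (s≤s b<n) = cut-< b<n

cut-≥ : ∀ {n b} → n ≤ b → cut n b ≡ 0ℙ
cut-≥ {zero}          _         = refl
cut-≥ {suc n} {suc b} (s≤s n≤b) = cut-≥ n≤b

readRows : (q : ℕ) .{{_ : ℕ.NonZero q}} → (ℕ → ℕ → Parity) → Series
readRows q F k = F (k % q) (k / q)

readRows-at : ∀ q .{{_ : ℕ.NonZero q}} F {a} b → a ℕ.< q → readRows q F (a + b * q) ≡ F a b
readRows-at q F {a} b a<q = cong₂ F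
  (trans ([m+kn]%n≡m%n a b q) (m<n⇒m%n≡m a<q))
  (trans (+-distrib-/-∣ʳ a (n∣m*n b)) (cong₂ _+_ (m<n⇒m/n≡0 a<q) (m*n/n≡m b q)))

≗-byRows : ∀ n (s t : Series) →
  (∀ a b → a ≤ n → s (a + b * suc n) ≡ t (a + b * suc n)) → s ≗ t
≗-byRows n s t e k = subst (λ j → s j ≡ t j) (sym (m≡m%n+[m/n]*n k (suc n)))
  (e (k % suc n) (k / suc n) (ℕₚ.≤-pred (m%n<n k (suc n))))

-- The monomial x^(cq) sits in column 0 of row c. The induction strips one full row from both
-- exponents.
δ-byRows : ∀ {n a} c b → a ≤ n → δ (c * suc n) (a + b * suc n) ≡ δ 0 a ⊗ δ c b
δ-byRows {n} {zero}  zero    zero    a≤n = refl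
δ-byRows {n} {suc a} zero    zero    a≤n = refl
δ-byRows {n} {a}     zero    (suc b) a≤n =
  trans (cong (δ 0) (+-suc a (n + b * suc n))) (sym (ℙₚ.*-zeroʳ (δ 0 a)))
δ-byRows {n} {a}     (suc c) zero    a≤n = trans (δ-≢ (ℕₚ.<⇒≢ (ℕₚ.<-≤-trans
  (s≤s (subst (_≤ n) (sym (ℕₚ.+-identityʳ a)) a≤n)) (ℕₚ.m≤m+n (suc n) (c * suc n))) ∘ sym))
  (sym (ℙₚ.*-zeroʳ (δ 0 a)))
δ-byRows {n} {a}     (suc c) (suc b) a≤n = begin
  δ (suc n + c * suc n) (a + (suc n + b * suc n)) ≡⟨ cong (δ (suc n + c * suc n)) (+-swap a (suc n) _) ⟩
  δ (suc n + c * suc n) (suc n + (a + b * suc n)) ≡⟨ shift-δ (suc n) (c * suc n) (suc n + (a + b * suc n)) ⟨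
  shift (suc n) (δ (c * suc n)) (suc n + (a + b * suc n)) ≡⟨ shift-+ (suc n) (δ (c * suc n)) (a + b * suc n) ⟩
  δ (c * suc n) (a + b * suc n) ≡⟨ δ-byRows c b a≤n ⟩
  δ 0 a ⊗ δ c b ∎
  where open ≡-Reasoning

-- The polynomial f and its quotient series

fR : ℕ → Poly
fR q = fourTerms 2 q (q + 1)

-- 1 + x² + x^q + x^(q+1) = (1 + x + x^q) (1 + x)
fR-⋆ : ∀ q s → let w = s ⊞ shift 1 s in fR q ⋆ s ≗ w ⊞ shift 1 w ⊞ shift q w
fR-⋆ q s k = begin
  (fR q ⋆ s) k
    ≡⟨ ⋆-distribʳ (1ₚ +ₚ X^ 2 +ₚ X^ q) (X^ (q + 1)) s k ⟩
  ((1ₚ +ₚ X^ 2 +ₚ X^ q) ⋆ s) k ⊕ (X^ (q + 1) ⋆ s) k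
    ≡⟨ cong₂ _⊕_ (⋆-distribʳ (1ₚ +ₚ X^ 2) (X^ q) s k) (X^-⋆ (q + 1) s k) ⟩
  ((1ₚ +ₚ X^ 2) ⋆ s) k ⊕ (X^ q ⋆ s) k ⊕ shift (q + 1) s k
    ≡⟨ cong₂ (λ c d → c ⊕ d ⊕ shift (q + 1) s k) (⋆-distribʳ 1ₚ (X^ 2) s k) (X^-⋆ q s k) ⟩
  (1ₚ ⋆ s) k ⊕ (X^ 2 ⋆ s) k ⊕ shift q s k ⊕ shift (q + 1) s k
    ≡⟨ cong₂ (λ c d → c ⊕ d ⊕ shift q s k ⊕ shift (q + 1) s k) (X^-⋆ 0 s k) (X^-⋆ 2 s k) ⟩
  s k ⊕ shift 2 s k ⊕ shift q s k ⊕ shift (q + 1) s k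
    ≡⟨ ℙₚ.+-assoc (s k ⊕ shift 2 s k) (shift q s k) (shift (q + 1) s k) ⟩
  s k ⊕ shift 2 s k ⊕ (shift q s k ⊕ shift (q + 1) s k)
    ≡⟨ cong₂ _⊕_ (insert (s k) (shift 1 s k) (shift 2 s k)) (cong (shift q s k ⊕_) (sym (shift-shift q 1 s k))) ⟩
  s k ⊕ shift 1 s k ⊕ (shift 1 s k ⊕ shift 2 s k) ⊕ (shift q s k ⊕ shift q (shift 1 s) k)
    ≡⟨ cong₂ (λ c d → s k ⊕ shift 1 s k ⊕ c ⊕ d)
         (trans (cong (shift 1 s k ⊕_) (sym (shift-shift 1 1 s k))) (sym (shift-⊞ 1 s (shift 1 s) k)))
         (sym (shift-⊞ q s (shift 1 s) k)) ⟩
  (w ⊞ shift 1 w ⊞ shift q w) k ∎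
  where
  open ≡-Reasoning
  w = s ⊞ shift 1 s
  insert : ∀ a b c → a ⊕ c ≡ a ⊕ b ⊕ (b ⊕ c)
  insert a b c = sym (begin
    a ⊕ b ⊕ (b ⊕ c)   ≡⟨ ℙₚ.+-assoc a b (b ⊕ c) ⟩
    a ⊕ (b ⊕ (b ⊕ c)) ≡⟨ cong (a ⊕_) (ℙₚ.+-assoc b b c) ⟨
    a ⊕ (b ⊕ b ⊕ c)   ≡⟨ cong (λ e → a ⊕ (e ⊕ c)) (p+p≡0ℙ b) ⟩
    a ⊕ c             ∎)

-- Powers of two enter only through `last-row`. Starting from n = q - 1 makes q a literal successor,
-- so `suc M` and `q * q` agree by computation.
module PascalQuotient (n : ℕ) (2≤n : 2 ≤ n)
         (last-row : ∀ {a} → 1 ≤ a → a ≤ n → pascal a n ≡ 0ℙ) where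

  q M : ℕ
  q = suc n
  M = n + n * q

  last-column : ∀ {b} → 1 ≤ b → b ≤ n → pascal n b ≡ 0ℙ
  last-column {b} 1≤b b≤n = trans (pascal-comm n b) (last-row 1≤b b≤n)

  1≤n : 1 ≤ n
  1≤n = ≤-trans (s≤s z≤n) 2≤n

  pascalTable quotientTable : ℕ → ℕ → Parity
  pascalTable   a b = cut q b ⊗ pascal a b
  quotientTable a b = cut n b ⊗ (1ℙ ⊕ pascal a (suc b))

  G V : Series
  G = readRows q pascalTable
  V = readRows q quotientTable

  G-at : ∀ {a} b → a ≤ n → G (a + b * q) ≡ pascalTable a b
  G-at b a≤n = readRows-at q pascalTable b (s≤s a≤n)

  V-at : ∀ {a} b → a ≤ n → V (a + b * q) ≡ quotientTable a b
  V-at b a≤n = readRows-at q quotientTable b (s≤s a≤n)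

  V-zero : V 0 ≡ 0ℙ
  V-zero = trans (V-at 0 z≤n) (ℙₚ.*-zeroʳ (cut n 0))

  -- Multiplication by x moves one column on, from column n into column 0 of the next row;
  -- multiplication by x^q moves one row on. Inside the table and off column 0 the three terms
  -- cancel by Pascal's rule. The wrapped column n is zero except in row 0, whose end accounts for
  -- x^q.
  G-equation : ∀ a b → a ≤ n →
    (G ⊞ shift 1 G ⊞ shift q G) (a + b * q) ≡ (δ 0 ⊞ δ q ⊞ δ (q * q)) (a + b * q)
  G-equation a b a≤n = trans (lhs a b a≤n) (sym (trans
    (cong₂ _⊕_
      (cong₂ _⊕_ (δ-byRows 0 b a≤n)
        (trans (cong (λ c → δ c (a + b * q)) (sym (ℕₚ.*-identityˡ q))) (δ-byRows 1 b a≤n)))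
      (δ-byRows q b a≤n))
    (collect (δ 0 a) (δ 0 b) (δ 1 b) (δ q b))))
    where
    collect : ∀ d x y z → d ⊗ x ⊕ d ⊗ y ⊕ d ⊗ z ≡ d ⊗ (x ⊕ y ⊕ z)
    collect 0ℙ x y z = refl
    collect 1ℙ x y z = refl

    lhs : ∀ a b → a ≤ n → (G ⊞ shift 1 G ⊞ shift q G) (a + b * q) ≡ δ 0 a ⊗ (δ 0 b ⊕ δ 1 b ⊕ δ q b)
    lhs zero zero _ = cong₂ _⊕_ (cong (_⊕ 0ℙ) (G-at 0 z≤n)) refl
    lhs (suc a) zero a<n = cong₂ _⊕_ (cong₂ _⊕_ (G-at 0 a<n) (trans (G-at 0 (ℕₚ.<⇒≤ a<n)) (pascal-zeroʳ a)))
      (shift-< {q} G (s≤s (subst (_≤ n) (sym (ℕₚ.+-identityʳ (suc a))) a<n)))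
    lhs zero (suc b) _ = trans
      (cong₂ _⊕_ (cong₂ _⊕_ (G-at (suc b) z≤n) (G-at b ≤-refl)) (trans (shift-+ q G (b * q)) (G-at b z≤n)))
      (first b)
      where
      first : ∀ b → pascalTable 0 (suc b) ⊕ pascalTable n b ⊕ pascalTable 0 b ≡ δ 1 (suc b) ⊕ δ q (suc b)
      first zero rewrite cut-< 1≤n | pascal-zeroʳ n | δ-≢ {n} {0} (λ n≡0 → ℕₚ.<⇒≢ 1≤n (sym n≡0)) = refl
      first (suc b) with <-cmp (suc b) n
      ... | tri< b<n b≢n _ rewrite cut-< b<n | cut-< (ℕₚ.<⇒≤ b<n) | last-column {suc b} (s≤s z≤n) (ℕₚ.<⇒≤ b<n)
                         | δ-≢ {n} {suc b} (b≢n ∘ sym) = refl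
      -- This is row q, just past the table: only the entry 1 in column 0 of row n is carried into
      -- it, which yields x^(q²).
      ... | tri≈ _ refl _ rewrite cut-≥ (≤-refl {n}) | cut-< (≤-refl {n}) | last-column 1≤n ≤-refl
                         | δ-refl n = refl
      ... | tri> _ n≢b n<b rewrite cut-≥ (ℕₚ.<⇒≤ n<b) | cut-≥ (ℕₚ.≤-pred n<b) | δ-≢ {n} {suc b} (n≢b ∘ sym) = refl
    lhs (suc a) (suc b) a<n = trans
      (cong₂ _⊕_ (cong₂ _⊕_ (G-at (suc b) a<n) (G-at (suc b) (ℕₚ.<⇒≤ a<n)))
        (trans (cong (shift q G) (+-swap (suc a) q (b * q))) (trans (shift-+ q G (suc a + b * q)) (G-at b a<n))))
      later
      where
      cancel : ∀ x y → x ⊕ y ⊕ x ⊕ y ≡ 0ℙ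
      cancel 0ℙ 0ℙ = refl
      cancel 0ℙ 1ℙ = refl
      cancel 1ℙ 0ℙ = refl
      cancel 1ℙ 1ℙ = refl
      later : pascalTable (suc a) (suc b) ⊕ pascalTable a (suc b) ⊕ pascalTable (suc a) b ≡ 0ℙ
      later with <-cmp b n
      ... | tri< b<n _ _ rewrite cut-< b<n | cut-< (ℕₚ.m<n⇒m<1+n b<n) = cancel (pascal a (suc b)) (pascal (suc a) b)
      -- Row q again, off column 0: what remains is row n of Pascal's triangle, zero there.
      ... | tri≈ _ refl _ rewrite cut-≥ (≤-refl {n}) | cut-< (≤-refl {suc n}) = last-row (s≤s z≤n) a<n
      ... | tri> _ _ n<b rewrite cut-≥ (ℕₚ.<⇒≤ n<b) | cut-≥ n<b = refl

  -- Within a row, the sum of neighbours in `V` is Pascal's rule solved for `pascal (suc a) b`.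
  -- Complementing makes column 0 of `V` zero and puts 1 at the end of every row before row n; this
  -- 1 wraps around to give column 0 of the next row of `G`. Stopping before row n is consistent
  -- because that row of `G` is zero off column 0.
  V-equation : V ⊞ shift 1 V ≗ G ⊞ δ 0
  V-equation = ≗-byRows n (V ⊞ shift 1 V) (G ⊞ δ 0) rows
    where
    rows : ∀ a b → a ≤ n → (V ⊞ shift 1 V) (a + b * q) ≡ (G ⊞ δ 0) (a + b * q)
    rows zero zero _ = cong₂ _⊕_ V-zero (cong (_⊕ 1ℙ) (sym (G-at 0 z≤n)))
    rows zero (suc b) _ = trans (cong₂ _⊕_ (V-at (suc b) z≤n) (V-at b ≤-refl))
      (trans first (cong (_⊕ 0ℙ) (sym (G-at (suc b) z≤n))))
      where
      first : quotientTable 0 (suc b) ⊕ quotientTable n b ≡ pascalTable 0 (suc b) ⊕ 0ℙ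
      first with ℕₚ.<-≤-connex b n
      ... | inj₁ b<n rewrite cut-< b<n | last-column {suc b} (s≤s z≤n) b<n | ℙₚ.*-zeroʳ (cut n (suc b)) = refl
      ... | inj₂ n≤b rewrite cut-≥ n≤b | cut-≥ (ℕₚ.m≤n⇒m≤1+n n≤b) = refl
    rows (suc a) b a<n = trans (cong₂ _⊕_ (V-at b a<n) (V-at b (ℕₚ.<⇒≤ a<n)))
      (trans later (cong (_⊕ 0ℙ) (sym (G-at b a<n))))
      where
      cancel : ∀ x y → (x ⊕ y) ℙ.⁻¹ ⊕ x ℙ.⁻¹ ≡ y ⊕ 0ℙ
      cancel 0ℙ 0ℙ = refl
      cancel 0ℙ 1ℙ = refl
      cancel 1ℙ 0ℙ = refl
      cancel 1ℙ 1ℙ = refl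
      later : quotientTable (suc a) b ⊕ quotientTable a b ≡ pascalTable (suc a) b ⊕ 0ℙ
      later with <-cmp b n
      ... | tri< b<n _ _ rewrite cut-< b<n | cut-< (ℕₚ.m<n⇒m<1+n b<n) = cancel (pascal a (suc b)) (pascal (suc a) b)
      ... | tri≈ _ refl _ rewrite cut-≥ (≤-refl {n}) | cut-< (≤-refl {suc n}) | last-row (s≤s z≤n) a<n = refl
      ... | tri> _ _ n<b rewrite cut-≥ (ℕₚ.<⇒≤ n<b) | cut-≥ n<b = refl

  f : Poly
  f = fR q

  f-const : coeff f 0 ≡ 1ℙ
  f-const = coeff-fourTerms 2 q (q + 1) 0

  -- By the factorization, f V = (1 + x + x^q)(G + 1), which is (1 + x^q + x^(q²)) + (1 + x + x^q).
  f⋆V : f ⋆ V ≗ δ 1 ⊞ δ (suc M)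
  f⋆V k = begin
    (f ⋆ V) k
      ≡⟨ fR-⋆ q V k ⟩
    w k ⊕ shift 1 w k ⊕ shift q w k
      ≡⟨ cong₂ _⊕_ (cong₂ _⊕_ (V-equation k) (shift-w 1)) (shift-w q) ⟩
    (G k ⊕ δ 0 k) ⊕ (shift 1 G k ⊕ δ 1 k) ⊕ (shift q G k ⊕ δ q k)
      ≡⟨ cong (_⊕ (shift q G k ⊕ δ q k)) (⊕-interchange (G k) (δ 0 k) (shift 1 G k) (δ 1 k)) ⟩
    (G k ⊕ shift 1 G k) ⊕ (δ 0 k ⊕ δ 1 k) ⊕ (shift q G k ⊕ δ q k)
      ≡⟨ ⊕-interchange (G k ⊕ shift 1 G k) (δ 0 k ⊕ δ 1 k) (shift q G k) (δ q k) ⟩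
    (G k ⊕ shift 1 G k ⊕ shift q G k) ⊕ (δ 0 k ⊕ δ 1 k ⊕ δ q k)
      ≡⟨ cong (_⊕ (δ 0 k ⊕ δ 1 k ⊕ δ q k)) (≗-byRows n (G ⊞ shift 1 G ⊞ shift q G) (δ 0 ⊞ δ q ⊞ δ (q * q)) G-equation k) ⟩
    (δ 0 k ⊕ δ q k ⊕ δ (q * q) k) ⊕ (δ 0 k ⊕ δ 1 k ⊕ δ q k)
      ≡⟨ cancel (δ 0 k) (δ q k) (δ (q * q) k) (δ 1 k) ⟩
    δ 1 k ⊕ δ (q * q) k ∎
    where
    open ≡-Reasoning
    w = V ⊞ shift 1 V
    shift-w : ∀ c → shift c w k ≡ shift c G k ⊕ δ c k
    shift-w c = trans (shift-cong c V-equation k)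
      (trans (shift-⊞ c G (δ 0) k) (cong (shift c G k ⊕_) (shift-δ-zero c k)))
    cancel : ∀ x y z u → (x ⊕ y ⊕ z) ⊕ (x ⊕ u ⊕ y) ≡ u ⊕ z
    cancel 0ℙ 0ℙ z u = trans (cong (z ⊕_) (ℙₚ.+-identityʳ u)) (ℙₚ.+-comm z u)
    cancel 0ℙ 1ℙ 0ℙ 0ℙ = refl
    cancel 0ℙ 1ℙ 0ℙ 1ℙ = refl
    cancel 0ℙ 1ℙ 1ℙ 0ℙ = refl
    cancel 0ℙ 1ℙ 1ℙ 1ℙ = refl
    cancel 1ℙ 0ℙ 0ℙ 0ℙ = refl
    cancel 1ℙ 0ℙ 0ℙ 1ℙ = refl
    cancel 1ℙ 0ℙ 1ℙ 0ℙ = refl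
    cancel 1ℙ 0ℙ 1ℙ 1ℙ = refl
    cancel 1ℙ 1ℙ 0ℙ 0ℙ = refl
    cancel 1ℙ 1ℙ 0ℙ 1ℙ = refl
    cancel 1ℙ 1ℙ 1ℙ 0ℙ = refl
    cancel 1ℙ 1ℙ 1ℙ 1ℙ = refl

  -- The cofactor of f and the minimality of M

  V-tail : ∀ {k} → n * q ≤ k → V k ≡ 0ℙ
  V-tail {k} nq≤k = cong (_⊗ (1ℙ ⊕ pascal (k % q) (suc (k / q))))
    (cut-≥ (subst (_≤ k / q) (m*n/n≡m n q) (/-monoˡ-≤ q nq≤k)))

  V-rowEnd : ∀ {b} → b ℕ.< n → V (n + b * q) ≡ 1ℙ
  V-rowEnd {b} b<n = trans (V-at b ≤-refl)
    (cong₂ (λ c p → c ⊗ (1ℙ ⊕ p)) (cut-< b<n) (last-column (s≤s z≤n) b<n))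

  V-one : V 1 ≡ 1ℙ
  V-one = trans (V-at 0 1≤n) (cong (_⊗ 1ℙ) (cut-< 1≤n))

  -- This is x⁻¹ V: since `V` has constant term 0, division by x just drops it. The length M reaches
  -- past the start n q of the zero tail of `V`.
  H : Poly
  H = applyUpTo (V ∘ suc) M

  coeff-H : coeff H ≗ V ∘ suc
  coeff-H k with ℕₚ.<-≤-connex k M
  ... | inj₁ k<M = coeff-applyUpTo (V ∘ suc) k<M
  ... | inj₂ M≤k = trans (coeff-applyUpTo-≥ (V ∘ suc) M≤k)
    (sym (V-tail (≤-trans (ℕₚ.m≤n+m (n * q) n) (ℕₚ.m≤n⇒m≤1+n M≤k))))

  f⋆H : f ⋆ coeff H ≗ δ 0 ⊞ δ M
  f⋆H k = begin
    -- Multiply by x and read the coefficient one place higher, where `f⋆V` applies.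
    (f ⋆ coeff H) k              ≡⟨ ⋆-shift-1 f (coeff H) (suc k) ⟨
    (f ⋆ shift 1 (coeff H)) (suc k) ≡⟨ ⋆-cong f shifted (suc k) ⟩
    (f ⋆ V) (suc k)              ≡⟨ f⋆V (suc k) ⟩
    δ 0 k ⊕ δ M k                ∎
    where
    open ≡-Reasoning
    shifted : shift 1 (coeff H) ≗ V
    shifted zero    = sym V-zero
    shifted (suc k) = coeff-H k

  f*H≈1+X^M : f *ₚ H ≈ 1ₚ +ₚ X^ M
  f*H≈1+X^M k = trans (coeff-* f H k) (trans (f⋆H k) (sym (coeff-+ 1ₚ (X^ M) k)))

  -- V has an entry 1 at the end of every row but the last, so a window of n
  -- consecutive positions lies in the last row or meets an entry 1.
  one-before-tail : ∀ E → 1 ≤ E → E ℕ.< M →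
    ∃[ i ] (1 ≤ i × V i ≡ 1ℙ × n * q ≤ i + E × i + E ≤ M)
  one-before-tail E 1≤E E<M = search ((M ∸ E) % q) ((M ∸ E) / q)
      (ℕₚ.≤-pred (m%n<n (M ∸ E) q))
      (trans (cong (_+ E) (sym (m≡m%n+[m/n]*n (M ∸ E) q))) (ℕₚ.m∸n+n≡m (ℕₚ.<⇒≤ E<M)))
    where
    rowEnd : ∀ b → n + b * q ℕ.< M → V (n + b * q) ≡ 1ℙ
    rowEnd b lt = V-rowEnd (ℕₚ.*-cancelʳ-< q b n (ℕₚ.+-cancelˡ-< n (b * q) (n * q) lt))

    below : ∀ {i} → i + E ≤ M → i ℕ.< M
    below {i} le = ℕₚ.<-≤-trans (ℕₚ.m<m+n i 1≤E) le

    search : ∀ a b → a ≤ n → a + b * q + E ≡ M →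
      ∃[ i ] (1 ≤ i × V i ≡ 1ℙ × n * q ≤ i + E × i + E ≤ M)
    search a b a≤n eq with ℕₚ.m≤n⇒m<n∨m≡n a≤n
    -- Here M - E itself is the end of a row.
    search a b _ eq | inj₂ refl = n + b * q , ≤-trans 1≤n (ℕₚ.m≤m+n n (b * q)) ,
      rowEnd b (below (ℕₚ.≤-reflexive eq)) ,
      subst (n * q ≤_) (sym eq) (ℕₚ.m≤n+m (n * q) n) , ℕₚ.≤-reflexive eq
    -- In row 0 there is no earlier row end; position 1 carries a 1 and is close enough to M - E.
    search a zero _ eq | inj₁ a<n = 1 , s≤s z≤n , V-one ,
      ℕₚ.+-cancelˡ-≤ n (n * q) (1 + E) (subst (_≤ n + (1 + E)) eq
        (ℕₚ.+-mono-≤ (subst (_≤ n) (sym (ℕₚ.+-identityʳ a)) (ℕₚ.<⇒≤ a<n)) (ℕₚ.n≤1+n E))) ,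
      E<M
    -- The end of the preceding row lies a + 1 ≤ n places before M - E, still inside the window.
    search a (suc b) _ eq | inj₁ a<n = n + b * q , ≤-trans 1≤n (ℕₚ.m≤m+n n (b * q)) ,
      rowEnd b (below inside) ,
      ℕₚ.+-cancelˡ-≤ n (n * q) (n + b * q + E) (subst (_≤ n + (n + b * q + E)) eq′
        (ℕₚ.+-monoˡ-≤ (n + b * q + E) a<n)) ,
      inside
      where
      eq′ : suc a + (n + b * q + E) ≡ M
      eq′ = trans (sym (trans (cong (_+ E) (+-suc a (n + b * q))) (cong suc (+-assoc a (n + b * q) E)))) eq
      inside : n + b * q + E ≤ M
      inside = subst (n + b * q + E ≤_) eq′ (ℕₚ.m≤n+m (n + b * q + E) (suc a))

  -- If f s = 1 + x^E, cancelling f gives (1 + x^M) s = (1 + x^E) H. From E on, the coefficients of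
  -- s repeat with period M, so they vanish because s is finite. Then H has period E below M, which
  -- contradicts an entry 1 of `V` that E moves into the zero tail.
  minimal : ∀ E → 1 ≤ E → E ℕ.< M → ¬ (f ∣ₚ 1ₚ +ₚ X^ E)
  minimal E 1≤E E<M (s , f*s≈) = contradict (one-before-tail E 1≤E E<M)
    where
    open ≡-Reasoning
    S h : Series
    S = coeff s
    h = coeff H

    f⋆S : f ⋆ S ≗ δ 0 ⊞ δ E
    f⋆S k = trans (sym (coeff-* f s k)) (trans (f*s≈ k) (coeff-+ 1ₚ (X^ E) k))

    cross : S ⊞ shift M S ≗ h ⊞ shift E h
    cross = ⋆-cancel f f-const λ k → begin
      (f ⋆ (S ⊞ shift M S)) k                         ≡⟨ ⋆-X^+1 f S M E f⋆S k ⟩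
      (δ 0 k ⊕ δ E k) ⊕ (δ M k ⊕ δ (M + E) k)       ≡⟨ ⊕-interchange (δ 0 k) (δ E k) (δ M k) (δ (M + E) k) ⟩
      (δ 0 k ⊕ δ M k) ⊕ (δ E k ⊕ δ (M + E) k)       ≡⟨ cong (λ m → (δ 0 k ⊕ δ M k) ⊕ (δ E k ⊕ δ m k)) (+-comm M E) ⟩
      (δ 0 k ⊕ δ M k) ⊕ (δ E k ⊕ δ (E + M) k)       ≡⟨ ⋆-X^+1 f h E M f⋆H k ⟨
      (f ⋆ (h ⊞ shift E h)) k                         ∎

    h-tail : ∀ {k} → M ≤ k → h k ≡ 0ℙ
    h-tail = coeff-applyUpTo-≥ (V ∘ suc)

    S-step : ∀ j → S (E + j) ≡ S (M + (E + j))
    S-step j = sym (ℙₚ.+-cancelʳ-≡ (S (E + j)) _ _ (begin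
      S (M + (E + j)) ⊕ S (E + j)                 ≡⟨ cong (S (M + (E + j)) ⊕_) (shift-+ M S (E + j)) ⟨
      (S ⊞ shift M S) (M + (E + j))               ≡⟨ cross (M + (E + j)) ⟩
      h (M + (E + j)) ⊕ shift E h (M + (E + j))   ≡⟨ cong₂ (λ c k → c ⊕ shift E h k) (h-tail (ℕₚ.m≤m+n M (E + j))) (+-swap M E j) ⟩
      shift E h (E + (M + j))                     ≡⟨ shift-+ E h (M + j) ⟩
      h (M + j)                                   ≡⟨ h-tail (ℕₚ.m≤m+n M j) ⟩
      0ℙ                                          ≡⟨ p+p≡0ℙ (S (E + j)) ⟨
      S (E + j) ⊕ S (E + j)                       ∎))

    -- Each step advances by M ≥ 1, so `m` steps suffice to pass the end of the list `s`.
    S-zero : ∀ m j → length s ≤ m + j → S (E + j) ≡ 0ℙ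
    S-zero zero    j l≤ = coeff-≥length s (≤-trans l≤ (ℕₚ.m≤n+m j E))
    S-zero (suc m) j l≤ = trans (S-step j) (trans (cong S (+-swap M E j))
      (S-zero m (M + j) (≤-trans l≤ (subst (_≤ m + (M + j)) (+-suc m j)
        (ℕₚ.+-monoʳ-≤ m (ℕₚ.+-monoˡ-≤ j (≤-trans 1≤n (ℕₚ.m≤m+n n (n * q)))))))))

    periodic : ∀ {j} → E + j ℕ.< M → h (E + j) ≡ h j
    periodic {j} E+j<M = ℙₚ.+-cancelʳ-≡ (h j) _ _ (begin
      h (E + j) ⊕ h j                 ≡⟨ cong (h (E + j) ⊕_) (shift-+ E h j) ⟨
      (h ⊞ shift E h) (E + j)         ≡⟨ cross (E + j) ⟨
      S (E + j) ⊕ shift M S (E + j)   ≡⟨ cong₂ _⊕_ (S-zero (length s) j (ℕₚ.m≤m+n (length s) j)) (shift-< S E+j<M) ⟩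
      0ℙ                              ≡⟨ p+p≡0ℙ (h j) ⟨
      h j ⊕ h j                       ∎)

    contradict : ∃[ i ] (1 ≤ i × V i ≡ 1ℙ × n * q ≤ i + E × i + E ≤ M) → ⊥
    contradict (suc i , _ , Vi≡1 , tail , i+E≤M) = contradiction (begin
      1ℙ              ≡⟨ Vi≡1 ⟨
      V (suc i)       ≡⟨ coeff-H i ⟨
      h i             ≡⟨ periodic (subst (ℕ._< M) (+-comm i E) i+E≤M) ⟨
      h (E + i)       ≡⟨ coeff-H (E + i) ⟩
      V (suc (E + i)) ≡⟨ V-tail (subst (n * q ≤_) (cong suc (+-comm i E)) tail) ⟩
      0ℙ              ∎) λ ()

  -- Counting the ones and zeros of f*

  zeros-V : zeros V (q * q) ≡ squareSum q
  zeros-V = begin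
    zeros V (q * q)
      ≡⟨ ∑-byRows (λ k → bit (1ℙ ⊕ V k)) q q ⟩
    ∑ (λ b → ∑ (λ a → bit (1ℙ ⊕ V (a + b * q))) q) q
      ≡⟨ ∑-cong q (λ {b} _ → ∑-cong q (λ a<q → cong (λ x → bit (1ℙ ⊕ x)) (V-at b (ℕₚ.≤-pred a<q)))) ⟩
    ∑ rowZeros q
      ≡⟨ ∑-last rowZeros n ⟩
    -- The zero row n of `V` plays the part of row 0 of Pascal's triangle, which is all ones; the
    -- zeros in row b < n of `V` are the odd entries in row b + 1.
    rowZeros n + ∑ rowZeros n
      ≡⟨ cong₂ _+_
           (∑-cong q (λ {a} _ → cong bit (trans
             (cong (λ c → 1ℙ ⊕ c ⊗ (1ℙ ⊕ pascal a (suc n))) (cut-≥ {n} ≤-refl)) (sym (pascal-zeroʳ a)))))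
           (∑-cong n (λ {b} b<n → ∑-cong q (λ {a} _ → cong bit (trans
             (cong (λ c → 1ℙ ⊕ c ⊗ (1ℙ ⊕ pascal a (suc b))) (cut-< b<n))
             (ℙₚ.⁻¹-involutive (pascal a (suc b))))))) ⟩
    columnSum q 0 + ∑ (λ b → columnSum q (suc b)) n ∎
    where
    open ≡-Reasoning
    rowZeros : ℕ → ℕ
    rowZeros b = ∑ (λ a → bit (1ℙ ⊕ quotientTable a b)) q

  1≤M : 1 ≤ M
  1≤M = ≤-trans 1≤n (ℕₚ.m≤m+n n (n * q))

  f-order : Order f
  f-order = record
    { constant≡1 = f-const
    ; degree≥1   = subst (1 ≤_) (sym (deg-fourTerms 2<q+1 q<q+1)) (s≤s z≤n)
    ; ord        = M
    ; isOrder    = record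
      { positive = 1≤M
      ; divides  = H , f*H≈1+X^M
      ; least    = λ E 1≤E f∣ → ℕₚ.≮⇒≥ (λ E<M → minimal E 1≤E E<M f∣)
      }
    ; star       = H
    ; star-eq    = f*H≈1+X^M
    }
    where
    q<q+1 : q ℕ.< q + 1
    q<q+1 = ℕₚ.m<m+n q (s≤s z≤n)
    2<q+1 : 2 ℕ.< q + 1
    2<q+1 = ℕₚ.≤-<-trans (ℕₚ.m≤n⇒m≤1+n 2≤n) q<q+1

  module _ (o : Order f) where
    open Order o

    ord≡M : ord ≡ M
    ord≡M = ℕₚ.≤-antisym (least M 1≤M (H , f*H≈1+X^M))
      (ℕₚ.≮⇒≥ (λ ord<M → minimal ord positive ord<M divides))

    -- Both `star` and `H` solve the same equation once the orders agree, and f can be cancelled.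
    coeff-star : coeff star ≗ V ∘ suc
    coeff-star k = trans (⋆-cancel f f-const (λ j → begin
      (f ⋆ coeff star) j          ≡⟨ coeff-* f star j ⟨
      coeff (f *ₚ star) j         ≡⟨ star-eq j ⟩
      coeff (1ₚ +ₚ X^ ord) j      ≡⟨ cong (λ m → coeff (1ₚ +ₚ X^ m) j) ord≡M ⟩
      coeff (1ₚ +ₚ X^ M) j        ≡⟨ f*H≈1+X^M j ⟨
      coeff (f *ₚ H) j            ≡⟨ coeff-* f H j ⟩
      (f ⋆ coeff H) j             ∎) k) (coeff-H k)
      where open ≡-Reasoning

    ℓ₁-star : ℓ₁ star ≡ ones V (q * q)
    ℓ₁-star = begin
      ℓ₁ star
        ≡⟨ ℓ₁≡ones star (ℕₚ.m≤n+m (length star) M) ⟩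
      -- The list `star` may be shorter than M or have trailing zeros; padding to this length allows
      -- a split at M in every case.
      ones (coeff star) (M + length star)
        ≡⟨ ∑-split (λ k → bit (coeff star k)) M (length star) ⟩
      ones (coeff star) M + ones (λ j → coeff star (M + j)) (length star)
        ≡⟨ cong₂ _+_ (∑-cong M (λ {k} _ → cong bit (coeff-star k)))
             (∑-zero (length star) (λ j → cong bit (trans (coeff-star (M + j)) (V-tail (beyond j))))) ⟩
      ones (V ∘ suc) M + 0
        ≡⟨ ℕₚ.+-identityʳ _ ⟩
      ones (V ∘ suc) M
        ≡⟨ cong (λ x → bit x + ones (V ∘ suc) M) V-zero ⟨
      ones V (q * q) ∎
      where
      open ≡-Reasoning
      beyond : ∀ j → n * q ≤ suc (M + j)
      beyond j = ≤-trans (ℕₚ.m≤n+m (n * q) n) (ℕₚ.m≤n⇒m≤1+n (ℕₚ.m≤m+n M j))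

    ℓ₁-count : ℓ₁ star + squareSum q ≡ q * q
    ℓ₁-count = trans (cong₂ _+_ ℓ₁-star (sym zeros-V)) (ones+zeros V (q * q))

    ℓ₀-count : ℓ₀ (ord ∸ 1) star + 1 ≡ squareSum q
    ℓ₀-count = begin
      ℓ₀ (ord ∸ 1) star + 1              ≡⟨ cong (_+ 1) (ℓ₀≡zeros (ord ∸ 1) star) ⟩
      zeros (coeff star) (1 + (ord ∸ 1)) + 1 ≡⟨ cong (λ m → zeros (coeff star) m + 1) (trans (ℕₚ.m+[n∸m]≡n positive) ord≡M) ⟩
      zeros (coeff star) M + 1           ≡⟨ +-comm _ 1 ⟩
      -- The 1 in the definition of robustness is absorbed as the zero of `V` at position 0.
      1 + zeros (coeff star) M           ≡⟨ cong₂ (λ x y → bit (1ℙ ⊕ x) + y) (sym V-zero)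
                                              (∑-cong M (λ {k} _ → cong (λ x → bit (1ℙ ⊕ x)) (coeff-star k))) ⟩
      zeros V (q * q)                    ≡⟨ zeros-V ⟩
      squareSum q                        ∎
      where open ≡-Reasoning

-- The case q = 2^r

fR₁-reciprocal : ∀ r → 3 ≤ r → fR₁ r ≈ reciprocal (f₁ r)
fR₁-reciprocal r 3≤r k = trans
  (cong₂ (λ a b → coeff (fourTerms a b (q + 1)) k) two (sym (ℕₚ.m+n∸n≡m q 1)))
  (reciprocal-fourTerms {1} {q ∸ 1} {q + 1} 1<q+1 q∸1<q+1 (s≤s z≤n) (ℕₚ.∸-monoˡ-≤ 1 2≤q) k)
  where
  q = 2 ^ r
  2≤q : 2 ≤ q
  2≤q = ≤-trans (s≤s (s≤s z≤n)) (ℕₚ.^-monoʳ-≤ 2 3≤r)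
  1<q+1 : 1 ℕ.< q + 1
  1<q+1 = ≤-trans 2≤q (ℕₚ.m≤m+n q 1)
  q∸1<q+1 : q ∸ 1 ℕ.< q + 1
  q∸1<q+1 = ℕₚ.≤-<-trans (ℕₚ.m∸n≤m q 1) (ℕₚ.m<m+n q (s≤s z≤n))
  two : 2 ≡ q + 1 ∸ (q ∸ 1)
  two = sym (begin
    q + 1 ∸ (q ∸ 1)             ≡⟨ cong (λ m → m + 1 ∸ (q ∸ 1)) (ℕₚ.m+[n∸m]≡n {1} (ℕₚ.<⇒≤ 2≤q)) ⟨
    1 + (q ∸ 1) + 1 ∸ (q ∸ 1)   ≡⟨ cong (_∸ (q ∸ 1)) (+-comm (1 + (q ∸ 1)) 1) ⟩
    2 + (q ∸ 1) ∸ (q ∸ 1)       ≡⟨ ℕₚ.m+n∸n≡m 2 (q ∸ 1) ⟩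
    2                           ∎)
    where open ≡-Reasoning

2≤mersenne : ∀ {r} → 3 ≤ r → 2 ≤ mersenne r
2≤mersenne (s≤s (s≤s (s≤s _))) = s≤s (s≤s z≤n)

4^r≡2^r*2^r : ∀ r → 4 ^ r ≡ 2 ^ r * 2 ^ r
4^r≡2^r*2^r r = trans (ℕₚ.^-*-assoc 2 2 r)
  (trans (ℕₚ.^-distribˡ-+-* 2 r (r + 0)) (cong (λ m → 2 ^ r * 2 ^ m) (ℕₚ.+-identityʳ r)))

order-fR₁ : ∀ r → 3 ≤ r → Order (fR₁ r)
order-fR₁ r 3≤r = subst (Order ∘ fR) (sym (2^r≡1+mersenne r)) f-order
  where open PascalQuotient (mersenne r) (2≤mersenne 3≤r) (pascal-mersenne r)

module _ (r : ℕ) (3≤r : 3 ≤ r) where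
  open PascalQuotient (mersenne r) (2≤mersenne 3≤r) (pascal-mersenne r)

  -- The type of `o` depends on q, so all counts are bundled into one predicate of q that can be
  -- transported from `suc (mersenne r)` to 2^r.
  Counts : ℕ → Set
  Counts q = (o : Order (fR q)) → let open Order o in
    ord ≡ q * q ∸ 1 × ℓ₁ star + squareSum q ≡ q * q × ℓ₀ (ord ∸ 1) star + 1 ≡ squareSum q

  counts : Counts (2 ^ r)
  counts = subst Counts (sym (2^r≡1+mersenne r)) (λ o → ord≡M o , ℓ₁-count o , ℓ₀-count o)

  module _ (o : Order (fR₁ r)) where
    open Order o

    ord≡4^r∸1 : ord ≡ 4 ^ r ∸ 1
    ord≡4^r∸1 = trans (proj₁ (counts o)) (cong (_∸ 1) (sym (4^r≡2^r*2^r r)))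

    ℓ₁+3^r≡4^r : ℓ₁ star + 3 ^ r ≡ 4 ^ r
    ℓ₁+3^r≡4^r = trans (cong (ℓ₁ star +_) (sym (squareSum-2^ r)))
      (trans (proj₁ (proj₂ (counts o))) (sym (4^r≡2^r*2^r r)))

    ℓ₀+1≡3^r : ℓ₀ (ord ∸ 1) star + 1 ≡ 3 ^ r
    ℓ₀+1≡3^r = trans (proj₂ (proj₂ (counts o))) (squareSum-2^ r)

-- Robustness

2*3^r<4^r : ∀ {r} → 3 ≤ r → 3 ^ r + 3 ^ r ℕ.< 4 ^ r
2*3^r<4^r {r} 3≤r = subst (λ m → 3 ^ m + 3 ^ m ℕ.< 4 ^ m) (ℕₚ.m∸n+n≡m 3≤r) (go (r ∸ 3))
  where
  go : ∀ k → 3 ^ (k + 3) + 3 ^ (k + 3) ℕ.< 4 ^ (k + 3)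
  -- The base case r = 3 is 54 < 64, written as 55 ≤ 55 + 9; at r = 2 the inequality fails, 18
  -- against 16.
  go zero = ℕₚ.m≤m+n 55 9
  go (suc k) = begin-strict
    3 * 3 ^ (k + 3) + 3 * 3 ^ (k + 3)   ≡⟨ ℕₚ.*-distribˡ-+ 3 (3 ^ (k + 3)) (3 ^ (k + 3)) ⟨
    3 * (3 ^ (k + 3) + 3 ^ (k + 3))     <⟨ ℕₚ.*-monoʳ-< 3 (go k) ⟩
    3 * 4 ^ (k + 3)                     ≤⟨ ℕₚ.*-monoˡ-≤ (4 ^ (k + 3)) (ℕₚ.n≤1+n 3) ⟩
    4 * 4 ^ (k + 3)                     ∎
    where open ℕₚ.≤-Reasoning

robust-fR₁ : ∀ r (3≤r : 3 ≤ r) (o : Order (fR₁ r)) → Robust o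
robust-fR₁ r 3≤r o = subst (ℕ._< ℓ₁ star) (sym (ℓ₀+1≡3^r r 3≤r o))
  (ℕₚ.+-cancelʳ-< (3 ^ r) (3 ^ r) (ℓ₁ star)
    (subst (3 ^ r + 3 ^ r ℕ.<_) (sym (ℓ₁+3^r≡4^r r 3≤r o)) (2*3^r<4^r 3≤r)))
  where open Order o

-- Bernoulli's inequality for (4/3)^r, without denominators.
bernoulli-4/3 : ∀ r → (3 + r) * 3 ^ r ≤ 3 * 4 ^ r
bernoulli-4/3 zero = ≤-refl
bernoulli-4/3 (suc r) = begin
  (3 + suc r) * (3 * 3 ^ r)   ≡⟨ ℕₚ.*-assoc (3 + suc r) 3 (3 ^ r) ⟨
  (3 + suc r) * 3 * 3 ^ r     ≤⟨ ℕₚ.*-monoˡ-≤ (3 ^ r) step ⟩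
  4 * (3 + r) * 3 ^ r         ≡⟨ ℕₚ.*-assoc 4 (3 + r) (3 ^ r) ⟩
  4 * ((3 + r) * 3 ^ r)       ≤⟨ ℕₚ.*-monoʳ-≤ 4 (bernoulli-4/3 r) ⟩
  4 * (3 * 4 ^ r)             ≡⟨ ℕₚ.*-assoc 4 3 (4 ^ r) ⟨
  12 * 4 ^ r                  ≡⟨ ℕₚ.*-assoc 3 4 (4 ^ r) ⟩
  3 * (4 * 4 ^ r)             ∎
  where
  open ℕₚ.≤-Reasoning
  step : (3 + suc r) * 3 ≤ 4 * (3 + r)
  step = begin
    (4 + r) * 3      ≡⟨ ℕₚ.*-distribʳ-+ 3 4 r ⟩
    12 + r * 3       ≡⟨ cong (12 +_) (ℕₚ.*-comm r 3) ⟩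
    12 + 3 * r       ≤⟨ ℕₚ.+-monoʳ-≤ 12 (ℕₚ.*-monoˡ-≤ r (ℕₚ.n≤1+n 3)) ⟩
    12 + 4 * r       ≡⟨ ℕₚ.*-distribˡ-+ 4 3 r ⟨
    4 * (3 + r)      ∎

-- A quantitative form of (4/3)^r → ∞: Bernoulli gives (4/3)^r ≥ 1 + r/3.
exponential-gap : ∀ d r → 3 * d ≤ r → suc d * 3 ^ r ≤ 4 ^ r
exponential-gap d r 3d≤r = ℕₚ.*-cancelˡ-≤ 3 (begin
  3 * (suc d * 3 ^ r)   ≡⟨ ℕₚ.*-assoc 3 (suc d) (3 ^ r) ⟨
  3 * suc d * 3 ^ r     ≡⟨ cong (_* 3 ^ r) (ℕₚ.*-suc 3 d) ⟩
  (3 + 3 * d) * 3 ^ r   ≤⟨ ℕₚ.*-monoˡ-≤ (3 ^ r) (ℕₚ.+-monoʳ-≤ 3 3d≤r) ⟩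
  (3 + r) * 3 ^ r       ≤⟨ bernoulli-4/3 r ⟩
  3 * 4 ^ r             ∎)
  where open ℕₚ.≤-Reasoning

-- The limit of γ

∣L/D-1∣<ε : ∀ {L Z D p d} .{{_ : ℕ.NonZero D}} .(c : Coprime (suc p) (suc d)) → L + Z ≡ D → Z * suc d ℕ.< suc p * D →
  ∣ (ℤ.+ L) ℚ./ D - 1ℚ ∣ < mkℚ (ℤ.+ suc p) d c
-- The distance is Z / (L + Z). Unnormalised rationals keep this fraction unreduced, so the claim
-- becomes the cross-multiplied inequality `small`. From here `D` is the denominator minus one, as
-- `mkℚᵘ` stores it.
∣L/D-1∣<ε {L} {Z} {suc D} {p} {d} c L+Z≡D small = ℚₚ.toℚᵘ-cancel-<
  (ℚᵘₚ.<-respˡ-≃ (ℚᵘₚ.≃-sym distance) (*<* (subst₂ ℤ._<_ (ℤₚ.pos-* Z (suc d)) (ℤₚ.pos-* (suc p) (suc D)) (ℤ.+<+ small))))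
  where
  γ′ : ℚ
  γ′ = (ℤ.+ L) ℚ./ suc D

  numerator : ℤ.+ L ℤ.* ℤ.1ℤ ℤ.+ ℤ.-1ℤ ℤ.* ℤ.+ suc D ≡ ℤ.- (ℤ.+ Z)
  numerator = begin
    ℤ.+ L ℤ.* ℤ.1ℤ ℤ.+ ℤ.-1ℤ ℤ.* ℤ.+ suc D   ≡⟨ cong₂ ℤ._+_ (ℤₚ.*-identityʳ (ℤ.+ L)) (ℤₚ.-1*i≡-i (ℤ.+ suc D)) ⟩
    ℤ.+ L ℤ.- ℤ.+ suc D                     ≡⟨ cong (λ m → ℤ.+ L ℤ.- ℤ.+ m) L+Z≡D ⟨
    ℤ.+ L ℤ.- (ℤ.+ L ℤ.+ ℤ.+ Z)             ≡⟨ cong (ℤ._+_ (ℤ.+ L)) (ℤₚ.neg-distrib-+ (ℤ.+ L) (ℤ.+ Z)) ⟩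
    ℤ.+ L ℤ.+ (ℤ.- ℤ.+ L ℤ.- ℤ.+ Z)         ≡⟨ ℤₚ.+-assoc (ℤ.+ L) (ℤ.- ℤ.+ L) (ℤ.- ℤ.+ Z) ⟨
    (ℤ.+ L ℤ.- ℤ.+ L) ℤ.- ℤ.+ Z             ≡⟨ cong (ℤ._- ℤ.+ Z) (ℤₚ.+-inverseʳ (ℤ.+ L)) ⟩
    ℤ.0ℤ ℤ.- ℤ.+ Z                          ≡⟨ ℤₚ.+-identityˡ (ℤ.- ℤ.+ Z) ⟩
    ℤ.- ℤ.+ Z                               ∎
    where open ≡-Reasoning

  difference : mkℚᵘ (ℤ.+ L) D ℚᵘ.+ ℚᵘ.- ℚᵘ.1ℚᵘ ℚᵘ.≃ ℚᵘ.- mkℚᵘ (ℤ.+ Z) D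
  difference = *≡* (cong₂ ℤ._*_ numerator (cong (ℤ.+_) (sym (ℕₚ.*-identityʳ (suc D)))))

  distance : ℚ.toℚᵘ ∣ γ′ - 1ℚ ∣ ℚᵘ.≃ mkℚᵘ (ℤ.+ Z) D
  distance = begin
    ℚ.toℚᵘ ∣ γ′ - 1ℚ ∣                               ≈⟨ ℚₚ.toℚᵘ-homo-∣-∣ (γ′ - 1ℚ) ⟩
    ℚᵘ.∣ ℚ.toℚᵘ (γ′ - 1ℚ) ∣                          ≈⟨ ℚᵘₚ.∣-∣-cong (ℚₚ.toℚᵘ-homo-+ γ′ (ℚ.- 1ℚ)) ⟩
    ℚᵘ.∣ ℚ.toℚᵘ γ′ ℚᵘ.+ ℚᵘ.- ℚᵘ.1ℚᵘ ∣                ≈⟨ ℚᵘₚ.∣-∣-cong (ℚᵘₚ.+-congˡ (ℚᵘ.- ℚᵘ.1ℚᵘ) (ℚₚ.toℚᵘ-fromℚᵘ (mkℚᵘ (ℤ.+ L) D))) ⟩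
    ℚᵘ.∣ mkℚᵘ (ℤ.+ L) D ℚᵘ.+ ℚᵘ.- ℚᵘ.1ℚᵘ ∣          ≈⟨ ℚᵘₚ.∣-∣-cong difference ⟩
    ℚᵘ.∣ ℚᵘ.- mkℚᵘ (ℤ.+ Z) D ∣                       ≈⟨ ℚᵘₚ.∣-p∣≃∣p∣ (mkℚᵘ (ℤ.+ Z) D) ⟩
    mkℚᵘ (ℤ.+ Z) D                                   ∎
    where open ≈-Reasoning ℚᵘₚ.≃-setoid

γ-close : ∀ p d .(c : Coprime (suc p) (suc d)) r → 3 ≤ r → 3 * suc d ≤ r → ∀ (o : Order (fR₁ r)) →
  ∣ γ o - 1ℚ ∣ < mkℚ (ℤ.+ suc p) d c
γ-close p d c r 3≤r large o = ∣L/D-1∣<ε {ℓ₁ star} {Z} {ord} {p} {d} {{ℕ.>-nonZero positive}} c split small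
  where
  open Order o
  instance _ = ℕₚ.m^n≢0 3 r
  instance _ = ℕₚ.m^n≢0 4 r
  -- The order is 4^r - 1 and f* has 4^r - 3^r ones, which leaves 3^r - 1 zeros.
  Z = pred (3 ^ r)
  sucZ : suc Z ≡ 3 ^ r
  sucZ = ℕₚ.suc-pred (3 ^ r)
  sucOrd : suc ord ≡ 4 ^ r
  sucOrd = trans (cong suc (ord≡4^r∸1 r 3≤r o)) (ℕₚ.m+[n∸m]≡n (ℕₚ.m^n>0 4 r))
  split : ℓ₁ star + Z ≡ ord
  split = ℕₚ.suc-injective (begin
    suc (ℓ₁ star + Z)   ≡⟨ +-suc (ℓ₁ star) Z ⟨
    ℓ₁ star + suc Z     ≡⟨ cong (ℓ₁ star +_) sucZ ⟩
    ℓ₁ star + 3 ^ r     ≡⟨ ℓ₁+3^r≡4^r r 3≤r o ⟩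
    4 ^ r               ≡⟨ sucOrd ⟨
    suc ord             ∎)
    where open ≡-Reasoning
  small : Z * suc d ℕ.< suc p * ord
  -- As ε ≥ 1/(d + 1), it is enough that Z (d + 1) < `ord`. The gap is taken with d + 2 in place of
  -- d + 1 to absorb the two subtracted ones.
  small = ℕₚ.<-≤-trans (ℕₚ.≤-pred (begin
    2 + Z * suc d                 ≤⟨ ℕₚ.+-mono-≤ (s≤s (s≤s (z≤n {d + Z}))) (ℕₚ.≤-reflexive (ℕₚ.*-comm Z (suc d))) ⟩
    2 + (d + Z) + suc d * Z       ≡⟨ cong (λ m → suc m + suc d * Z) (+-suc d Z) ⟨
    (suc d + suc Z) + suc d * Z   ≡⟨ cong (_+ suc d * Z) (+-comm (suc d) (suc Z)) ⟩
    (suc Z + suc d) + suc d * Z   ≡⟨ +-assoc (suc Z) (suc d) (suc d * Z) ⟩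
    suc Z + (suc d + suc d * Z)   ≡⟨ cong (suc Z +_) (ℕₚ.*-suc (suc d) Z) ⟨
    suc (suc d) * suc Z           ≡⟨ cong (suc (suc d) *_) sucZ ⟩
    suc (suc d) * 3 ^ r           ≤⟨ exponential-gap (suc d) r large ⟩
    4 ^ r                         ≡⟨ sucOrd ⟨
    suc ord                       ∎)) (ℕₚ.m≤n*m ord (suc p))
    where open ℕₚ.≤-Reasoning

mainTheorem2 : (∀ (r : ℕ) → 3 ≤ r →
    fR₁ r ≈ reciprocal (f₁ r)
    × Order (fR₁ r)
    × (∀ (o : Order (fR₁ r)) → Robust o × Order.ord o ∣ 4 ^ r ∸ 1))
    × (∀ (ε : ℚ) → 0ℚ < ε →
    ∃[ N ] (∀ (r : ℕ) → 3 ≤ r → N ≤ r →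
    ∀ (o : Order (fR₁ r)) → ∣ γ o - 1ℚ ∣ < ε))
mainTheorem2 =
  (λ r 3≤r → fR₁-reciprocal r 3≤r , order-fR₁ r 3≤r ,
    λ o → robust-fR₁ r 3≤r o , ∣-reflexive (ord≡4^r∸1 r 3≤r o)) ,
  limit
  where
  limit : ∀ (ε : ℚ) → 0ℚ < ε → ∃[ N ] (∀ (r : ℕ) → 3 ≤ r → N ≤ r →
    ∀ (o : Order (fR₁ r)) → ∣ γ o - 1ℚ ∣ < ε)
  -- The threshold depends only on the denominator of ε, since its numerator is at least 1.
  limit (mkℚ (ℤ.+ suc p) d c) _ = 3 * suc d , γ-close p d c
  limit (mkℚ (ℤ.+ zero) d c) (ℚ.*<* (ℤ.+<+ ()))
  limit (mkℚ ℤ.-[1+ p ] d c) (ℚ.*<* ())
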